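{- Let $q$ be a prime power and $n\ge2$. There are exactly $$(q-1)^nq^{n(n-1)}=\left(1-\frac1q\right)^nq^{n^2}$$ nonsingular $n\times n$ matrices $M$ over $\mathrm{GF}(q)$ which can be computed simply by updating their rows from $1$ to $n$ in increasing order.
   Context: For $1\le i\le n$ and $v\in\mathrm{GF}(q)^n$ with $v_i\ne0$, let $S(i,v)$ be the $n\times n$ matrix obtained from the identity matrix $I_n$ by replacing its $i$-th row by $v$ (an invertible linear instruction updating row $i$; it may be the identity). Left multiplication of a matrix by $S(i,v)$ modifies only its $i$-th row. A nonsingular matrix $M$ can be computed by updating its rows from $1$ to $n$ in increasing order if there are $v^1,\dots,v^n\in\mathrm{GF}(q)^n$ with $v^i_i\neq0$ for all $i$ such that $M=S(n,v^n)\cdots S(2,v^2)S(1,v^1)$; equivalently, if there is a sequence of nonsingular matrices $N_0=I_n,N_1,\dots,N_n=M$ where $N_{i-1}$ and $N_i$ differ at most in row $i$, for $1\le i\le n$. -}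

module Defs where

open import Algebra.Apartness.Bundles using (HeytingField; HeytingCommutativeRing)
open import Algebra.Bundles using (CommutativeRing)
import Algebra.Definitions as AlgebraDefinitions
import Algebra.Definitions.RawSemiring as RawSemiringDefinitions
import Algebra.Properties.Semiring.Sum as SemiringSum
open import Data.Bool.Base using (if_then_else_)
open import Data.Fin.Base using (Fin)
open import Data.Fin.Properties using (_≟_)
open import Data.Nat.Base using (ℕ; _^_; _≤_; NonZero)
open import Data.Nat.Primality using (Prime; prime⇒nonZero)
open import Data.Nat.Properties using (m^n≢0)
open import Data.Product.Base using (Σ-syntax; ∃₂; _×_; _,_; proj₁)
open import Data.Rational.Base using (ℚ; +-*-rawSemiring)
open import Data.Vec.Functional using (Vector; foldl; updateAt)
import Data.Vec.Functional.Relation.Binary.Equality.Setoid as VectorEquality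
open import Function.Base using (const)
open import Function.Bundles using (Inverse)
open import Level using (Level; _⊔_)
open import Relation.Binary.Bundles using (Setoid)
import Relation.Binary.Construct.On as On
open import Relation.Binary.PropositionalEquality.Core using (_≡_; refl)
import Relation.Binary.PropositionalEquality.Properties as ≡
open import Relation.Nullary.Decidable.Core using (does)

IsPrimePower : ℕ → Set
IsPrimePower q = ∃₂ λ p k → Prime p × 1 ≤ k × q ≡ p ^ k

primePower⇒nonZero : ∀ {q} → IsPrimePower q → NonZero q
primePower⇒nonZero (p , k , p-prime , _ , refl) =
  m^n≢0 p k {{prime⇒nonZero p-prime}}

infixr 8 _^ℚ_

_^ℚ_ : ℚ → ℕ → ℚ
_^ℚ_ = RawSemiringDefinitions._^_ +-*-rawSemiring

HasCardinality : ∀ {a ℓ} → Setoid a ℓ → ℕ → Set (a ⊔ ℓ)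
HasCardinality S k = Inverse S (≡.setoid (Fin k))

-- A model of GF(q) is a HeytingField whose setoid has cardinality q.
-- Finiteness makes _≈_ decidable and lets one search for inverses, so the
-- apartness then coincides with _≉_, and this is a field in the usual sense.

module RowUpdates {c ℓ₁ ℓ₂ : Level} (F : HeytingField c ℓ₁ ℓ₂) where

  open HeytingCommutativeRing (HeytingField.heytingCommutativeRing F)
    using (commutativeRing)
  open CommutativeRing commutativeRing
    using (Carrier; _≈_; _≉_; _*_; 0#; 1#; setoid; semiring)
  open SemiringSum semiring using (sum)

  -- Matrices are vectors of rows.
  Matrix : ℕ → Set c
  Matrix n = Vector (Vector Carrier n) n

  matrixSetoid : ℕ → Setoid c ℓ₁
  matrixSetoid n = VectorEquality.≋-setoid (VectorEquality.≋-setoid setoid n) n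

  infix 4 _≈ᴹ_

  _≈ᴹ_ : ∀ {n} → Matrix n → Matrix n → Set ℓ₁
  _≈ᴹ_ {n} = Setoid._≈_ (matrixSetoid n)

  I : ∀ n → Matrix n
  I n i j = if does (i ≟ j) then 1# else 0#

  infixl 7 _*ᴹ_

  _*ᴹ_ : ∀ {n} → Matrix n → Matrix n → Matrix n
  (A *ᴹ B) i j = sum λ k → A i k * B k j

  Nonsingular : ∀ {n} → Matrix n → Set (c ⊔ ℓ₁)
  Nonsingular {n} = AlgebraDefinitions.Invertible (_≈ᴹ_ {n}) (I n) _*ᴹ_

  S : ∀ {n} → Fin n → Vector Carrier n → Matrix n
  S {n} i v = updateAt (I n) i (const v)

  -- S(n,vⁿ) ⋯ S(2,v²) S(1,v¹): the left fold meets row 1 first and multiplies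
  -- each later instruction on the left.
  program : ∀ {n} → Vector (Vector Carrier n) n → Matrix n
  program {n} v = foldl (λ N Sᵢ → Sᵢ *ᴹ N) (I n) λ i → S i (v i)

  ComputableInOrder : ∀ {n} → Matrix n → Set (c ⊔ ℓ₁)
  ComputableInOrder {n} M =
    Σ[ v ∈ Vector (Vector Carrier n) n ] (∀ i → v i i ≉ 0#) × M ≈ᴹ program v

  -- Elements are compared as matrices only; the witnesses of nonsingularity
  -- and computability are ignored, so that cardinality counts matrices.
  computableMatrices : ℕ → Setoid (c ⊔ ℓ₁) ℓ₁
  computableMatrices n =
    On.setoid {B = Σ[ M ∈ Matrix n ] Nonsingular M × ComputableInOrder M}
      (matrixSetoid n) proj₁

{-# OPTIONS --safe #-}
module Submission where

-- A matrix determines the instructions computing it in order: row i of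
-- M = S(n,vⁿ) ⋯ S(1,v¹) is final after step i, so it equals vⁱ N for the
-- nonsingular matrix N computed by the first i − 1 steps.  Hence such matrices
-- correspond to sequences of vectors vⁱ with vⁱᵢ ≠ 0, and there are
-- (q − 1) qⁿ⁻¹ choices for each of the n vectors.

open import Defs
open import Algebra.Apartness.Bundles using (HeytingField; HeytingCommutativeRing)
open import Algebra.Bundles using (CommutativeRing)
import Algebra.Definitions as AlgebraDefinitions
import Algebra.Properties.CommutativeMonoid as CommutativeMonoidProperties
import Algebra.Properties.CommutativeSemiring.Exp as CommutativeExponent
import Algebra.Properties.Ring as RingProperties
import Algebra.Properties.Semiring.Exp as Exponent
import Algebra.Properties.Semiring.Sum as SemiringSum
open import Data.Fin.Base
  using (Fin; zero; suc; combine; remQuot; punchIn; punchOut; finToFun; funToFin)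
import Data.Fin.Properties as Fin
open import Data.Integer.Base as ℤ using (+_)
import Data.Integer.Properties as ℤ
open import Data.Nat.Base as ℕ using (ℕ; zero; suc; _∸_; _*_; _^_; _≤_; NonZero)
import Data.Nat.Properties as ℕ
open import Data.Product.Base using (Σ-syntax; _×_; _,_; proj₁; proj₂; uncurry)
open import Data.Product.Function.NonDependent.Setoid using (_×-inverse_)
open import Data.Product.Relation.Binary.Pointwise.NonDependent using (_×ₛ_)
open import Data.Rational.Base as ℚ using (1ℚ; _/_)
import Data.Rational.Properties as ℚ
open import Data.Rational.Unnormalised.Base as ℚᵘ using (mkℚᵘ; *≡*)
import Data.Rational.Unnormalised.Properties as ℚᵘ
open import Data.Vec.Functional using (Vector; foldl; insertAt; removeAt)
open import Data.Vec.Functional.Properties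
  using (updateAt-updates; updateAt-minimal; insertAt-lookup; removeAt-insertAt; insertAt-removeAt)
import Data.Vec.Functional.Relation.Binary.Equality.Setoid as VectorEquality
open import Function.Base using (_∘_; id)
open import Function.Bundles using (Inverse; Injection)
import Function.Construct.Composition as Composition
import Function.Consequences.Setoid as Consequences
open import Function.Definitions using (Congruent; Injective; StrictlyInverseˡ; StrictlyInverseʳ)
open import Function.Properties.Inverse using (Inverse⇒Injection)
open import Level using (Level; _⊔_)
open import Relation.Binary.Bundles using (Setoid)
import Relation.Binary.Construct.On as On
open import Relation.Binary.PropositionalEquality as ≡ using (_≡_; _≢_)
import Relation.Binary.Reasoning.Setoid as SetoidReasoning
open import Relation.Nullary.Decidable using (yes; no; via-injection)
open import Relation.Nullary.Negation using (¬_; contradiction)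

private variable
  a b ℓ ℓ₁ ℓ₂ : Level
  k l m n : ℕ

-- Cardinalities of setoids: removing a point, vectors, products.

module _ (S : Setoid a ℓ₁) (T : Setoid b ℓ₂) where
  private
    module S = Setoid S
    module T = Setoid T

  strictInverse : (f : S.Carrier → T.Carrier) (g : T.Carrier → S.Carrier) →
    Congruent S._≈_ T._≈_ f → Congruent T._≈_ S._≈_ g →
    StrictlyInverseˡ T._≈_ f g → StrictlyInverseʳ S._≈_ f g → Inverse S T
  strictInverse f g f-cong g-cong invˡ invʳ = record
    { to = f
    ; from = g
    ; to-cong = f-cong
    ; from-cong = g-cong
    ; inverse = strictlyInverseˡ⇒inverseˡ f-cong invˡ , strictlyInverseʳ⇒inverseʳ g-cong invʳ
    }
    where open Consequences S T

module _ (S : Setoid a ℓ) where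
  private module S = Setoid S
  open VectorEquality S using (_≋_; ≋-setoid)

  -- Equality looks at the first component only, so different proofs of `¬ (x S.≈ z)` do not inflate
  -- the count.
  excluding : S.Carrier → Setoid (a ⊔ ℓ) ℓ
  excluding z = On.setoid {B = Σ[ x ∈ S.Carrier ] ¬ (x S.≈ z)} S proj₁

  -- Transported to `Fin`, this is deletion of the point `to z`: `punchOut` closes the gap and
  -- `punchIn` reopens it. For `k = 0` the element `to z` would lie in the empty `Fin 0`.
  excluding-cardinality : ∀ z → HasCardinality S k → HasCardinality (excluding z) (k ∸ 1)
  excluding-cardinality {zero} z i with () ← Inverse.to i z
  excluding-cardinality {suc k} z i = strictInverse (excluding z) (≡.setoid (Fin k))
    (λ (x , x≉z) → punchOut (avoids x≉z))
    (λ j → from (punchIn (to z) j) ,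
           λ eq → Fin.punchInᵢ≢i (to z) j (≡.trans (≡.sym (strictlyInverseˡ _)) (to-cong eq)))
    (λ eq → Fin.punchOut-cong (to z) (to-cong eq))
    (λ { ≡.refl → S.refl })
    (λ j → ≡.trans (Fin.punchOut-cong (to z) (strictlyInverseˡ _)) (Fin.punchOut-punchIn (to z)))
    (λ (x , x≉z) → S.trans (from-cong (Fin.punchIn-punchOut (avoids x≉z))) (strictlyInverseʳ x))
    where
    open Inverse i
    avoids : ∀ {x} → ¬ (x S.≈ z) → to z ≢ to x
    avoids x≉z eq = x≉z (Injection.injective (Inverse⇒Injection i) (≡.sym eq))

  -- A vector is coded entrywise by a function `Fin n → Fin k`, whose values are then read as digits
  -- in base `k`.
  vector-cardinality : HasCardinality S k → ∀ n → HasCardinality (≋-setoid n) (k ^ n)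
  vector-cardinality {k} i n = strictInverse (≋-setoid n) (≡.setoid (Fin (k ^ n)))
    (λ xs → funToFin (to ∘ xs))
    (λ j → from ∘ finToFun j)
    (λ eq → funToFin-cong (to-cong ∘ eq))
    (λ { ≡.refl _ → S.refl })
    (λ j → ≡.trans (funToFin-cong {n} (strictlyInverseˡ ∘ finToFun j))
                   (Fin.funToFin-finToFin {n} {k} j))
    (λ xs j → S.trans (from-cong (Fin.finToFun-funToFin (to ∘ xs) j)) (strictlyInverseʳ (xs j)))
    where
    open Inverse i
    -- Entries agree only pointwise, and without function extensionality this needs its own
    -- induction.
    funToFin-cong : ∀ {m} {f g : Fin m → Fin k} → (∀ j → f j ≡ g j) → funToFin f ≡ funToFin g
    funToFin-cong {zero}  eq = ≡.refl
    funToFin-cong {suc m} eq = ≡.cong₂ combine (eq zero) (funToFin-cong (eq ∘ suc))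

  insertAt-cong : ∀ {xs ys : Vector S.Carrier n} i {x y} →
    xs ≋ ys → x S.≈ y → insertAt xs i x ≋ insertAt ys i y
  insertAt-cong {n}     zero    xs≋ys x≈y zero    = x≈y
  insertAt-cong {n}     zero    xs≋ys x≈y (suc j) = xs≋ys j
  insertAt-cong {suc n} (suc i) xs≋ys x≈y zero    = xs≋ys zero
  insertAt-cong {suc n} (suc i) xs≋ys x≈y (suc j) = insertAt-cong i (xs≋ys ∘ suc) x≈y j

×-cardinality : ∀ {S : Setoid a ℓ₁} {T : Setoid b ℓ₂} →
  HasCardinality S k → HasCardinality T l → HasCardinality (S ×ₛ T) (k * l)
×-cardinality {k = k} {l = l} i j = Composition.inverse (i ×-inverse j)
  (strictInverse (≡.setoid (Fin k) ×ₛ ≡.setoid (Fin l)) (≡.setoid (Fin (k * l)))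
    (uncurry combine)
    (remQuot l)
    (uncurry (≡.cong₂ combine))
    (λ { ≡.refl → ≡.refl , ≡.refl })
    (Fin.combine-remQuot {k} l)
    (λ (x , y) → ≡.cong proj₁ (Fin.remQuot-combine x y) , ≡.cong proj₂ (Fin.remQuot-combine x y)))

module Matrices {c ℓ₁ ℓ₂ : Level} (F : HeytingField c ℓ₁ ℓ₂) where

  open RowUpdates F
  open HeytingField F using (_#_; tight; #⇒invertible)
  open HeytingCommutativeRing (HeytingField.heytingCommutativeRing F) using (commutativeRing)
  open CommutativeRing commutativeRing hiding (zero) renaming (_*_ to _·_)
  open SemiringSum semiring
  open VectorEquality setoid using (_≋_; ≋-refl; ≋-sym; ≋-trans)
  open RingProperties ring using (x[y-z]≈xy-xz; //-rightDividesˡ; xyx⁻¹≈y; ⁻¹-anti-homo-//; -0#≈0#)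
  open CommutativeMonoidProperties *-commutativeMonoid using (invertibleˡ⇒invertible)

  private variable
    A B N N′ : Matrix n
    v w : Vector Carrier n

  -- Row vectors times matrices, and nonsingularity.

  infixl 7 _⊙_
  -- Row `i` of `A *ᴹ B` is definitionally `A i ⊙ B`, so matrix identities can be proved one row at
  -- a time.
  _⊙_ : Vector Carrier n → Matrix n → Vector Carrier n
  (v ⊙ A) j = sum λ k → v k · A k j

  ⊙-cong : v ≋ w → A ≈ᴹ B → v ⊙ A ≋ w ⊙ B
  ⊙-cong v≋w A≈B j = sum-cong-≋ λ k → *-cong (v≋w k) (A≈B k j)

  ⊙-assoc : (v : Vector Carrier n) (A B : Matrix n) → v ⊙ A ⊙ B ≋ v ⊙ (A *ᴹ B)
  ⊙-assoc v A B j = begin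
    sum (λ k → sum (λ i → v i · A i k) · B k j)
      ≈⟨ sum-cong-≋ (λ k → *-distribʳ-sum (B k j) (λ i → v i · A i k)) ⟩
    sum (λ k → sum (λ i → v i · A i k · B k j))
      ≈⟨ ∑-comm (λ k i → v i · A i k · B k j) ⟩
    sum (λ i → sum (λ k → v i · A i k · B k j))
      ≈⟨ sum-cong-≋ (λ i → trans (sum-cong-≋ (λ k → *-assoc (v i) (A i k) (B k j)))
                                 (sym (*-distribˡ-sum (v i) (λ k → A i k · B k j)))) ⟩
    sum (λ i → v i · sum (λ k → A i k · B k j)) ∎
    where open SetoidReasoning setoid

  sum-zero : ∀ {t : Vector Carrier n} → (∀ k → t k ≈ 0#) → sum t ≈ 0#
  sum-zero {n} t≈0 = trans (sum-cong-≋ t≈0) (sum-replicate-zero n)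

  -- Induction on `i` works because deleting the first row and column of `I (suc n)` leaves `I n` by
  -- computation.
  sum-Iˡ : ∀ i (t : Vector Carrier n) → sum (λ k → I n i k · t k) ≈ t i
  sum-Iˡ zero    t =
    trans (+-cong (*-identityˡ _) (sum-zero (λ k → zeroˡ (t (suc k))))) (+-identityʳ _)
  sum-Iˡ (suc i) t = trans (+-cong (zeroˡ _) (sum-Iˡ i (t ∘ suc))) (+-identityˡ _)

  *ᴹ-identityˡ : (A : Matrix n) → I n *ᴹ A ≈ᴹ A
  *ᴹ-identityˡ A i j = sum-Iˡ i (λ k → A k j)

  ⊙-identityʳ : (v : Vector Carrier n) → v ⊙ I n ≋ v
  ⊙-identityʳ v zero    =
    trans (+-cong (*-identityʳ _) (sum-zero (λ k → zeroʳ (v (suc k))))) (+-identityʳ _)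
  ⊙-identityʳ v (suc j) = trans (+-cong (zeroʳ _) (⊙-identityʳ (v ∘ suc) j)) (+-identityˡ _)

  ≈ᴹ-refl : A ≈ᴹ A
  ≈ᴹ-refl {n} {A} = Setoid.refl (matrixSetoid n) {A}

  -- Used twice in `*ᴹ-nonsingular`, with matrices and inverses exchanged, to obtain both halves of
  -- the inverse of a product.
  *ᴹ-cancelᶜ : ∀ {A A′ B B′ : Matrix n} → A *ᴹ A′ ≈ᴹ I n → B *ᴹ B′ ≈ᴹ I n →
    (A *ᴹ B) *ᴹ (B′ *ᴹ A′) ≈ᴹ I n
  *ᴹ-cancelᶜ {n} {A} {A′} {B} {B′} AA′ BB′ i = begin
    A i ⊙ B ⊙ (B′ *ᴹ A′)  ≈⟨ ⊙-assoc (A i ⊙ B) B′ A′ ⟨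
    A i ⊙ B ⊙ B′ ⊙ A′     ≈⟨ ⊙-cong (⊙-assoc (A i) B B′) (≈ᴹ-refl {A = A′}) ⟩
    A i ⊙ (B *ᴹ B′) ⊙ A′  ≈⟨ ⊙-cong (⊙-cong ≋-refl BB′) (≈ᴹ-refl {A = A′}) ⟩
    A i ⊙ I n ⊙ A′        ≈⟨ ⊙-cong (⊙-identityʳ (A i)) (≈ᴹ-refl {A = A′}) ⟩
    A i ⊙ A′              ≈⟨ AA′ i ⟩
    I n i                 ∎
    where open SetoidReasoning (VectorEquality.≋-setoid setoid n)

  I-nonsingular : Nonsingular (I n)
  I-nonsingular {n} = I n , *ᴹ-identityˡ (I n) , *ᴹ-identityˡ (I n)

  *ᴹ-nonsingular : Nonsingular A → Nonsingular B → Nonsingular (A *ᴹ B)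
  *ᴹ-nonsingular {A = A} {B = B} (A′ , A′A , AA′) (B′ , B′B , BB′) =
    B′ *ᴹ A′ ,
    *ᴹ-cancelᶜ {A = B′} {B} {A′} {A} B′B A′A ,
    *ᴹ-cancelᶜ {A = A} {A′} {B} {B′} AA′ BB′

  -- Multiply by a right inverse of `N`. This is what recovers an instruction vector from the row it
  -- produces.
  ⊙-cancelʳ : Nonsingular N → v ⊙ N ≋ w ⊙ N → v ≋ w
  ⊙-cancelʳ {n} {N} {v} {w} (N′ , _ , NN′) eq = begin
    v               ≈⟨ ⊙-identityʳ v ⟨
    v ⊙ I n         ≈⟨ ⊙-cong (≋-refl {x = v}) NN′ ⟨
    v ⊙ (N *ᴹ N′)   ≈⟨ ⊙-assoc v N N′ ⟨
    v ⊙ N ⊙ N′      ≈⟨ ⊙-cong eq (≈ᴹ-refl {A = N′}) ⟩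
    w ⊙ N ⊙ N′      ≈⟨ ⊙-assoc w N N′ ⟩
    w ⊙ (N *ᴹ N′)   ≈⟨ ⊙-cong (≋-refl {x = w}) NN′ ⟩
    w ⊙ I n         ≈⟨ ⊙-identityʳ w ⟩
    w               ∎
    where open SetoidReasoning (VectorEquality.≋-setoid setoid n)

  -- Single instructions and their inverses.

  S-row : ∀ i (v : Vector Carrier n) → S i v i ≋ v
  S-row i v j = reflexive (≡.cong (λ row → row j) (updateAt-updates i (I _)))

  S-row-other : ∀ {i r : Fin n} (v : Vector Carrier n) → r ≢ i → S i v r ≋ I n r
  S-row-other {i = i} {r} v r≢i j =
    reflexive (≡.cong (λ row → row j) (updateAt-minimal r i (I _) r≢i))

  S-*ᴹ-row : ∀ i (v : Vector Carrier n) A → (S i v *ᴹ A) i ≋ v ⊙ A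
  S-*ᴹ-row i v A = ⊙-cong (S-row i v) (≈ᴹ-refl {A = A})

  S-*ᴹ-row-other : ∀ {i r : Fin n} (v : Vector Carrier n) A → r ≢ i → (S i v *ᴹ A) r ≋ A r
  S-*ᴹ-row-other {r = r} v A r≢i =
    ≋-trans (⊙-cong (S-row-other v r≢i) (≈ᴹ-refl {A = A})) (*ᴹ-identityˡ A r)

  S-cong : ∀ (i : Fin n) {v w} → v ≋ w → S i v ≈ᴹ S i w
  S-cong i {v} {w} v≋w r with r Fin.≟ i
  ... | yes ≡.refl = ≋-trans (S-row i v) (≋-trans v≋w (≋-sym (S-row i w)))
  ... | no r≢i     = ≋-trans (S-row-other v r≢i) (≋-sym (S-row-other w r≢i))

  I-diagonal : ∀ (i : Fin n) → I n i i ≈ 1#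
  I-diagonal zero    = refl
  I-diagonal (suc i) = I-diagonal i

  y+[x-y]≈x : ∀ x y → y + (x - y) ≈ x
  y+[x-y]≈x x y = trans (+-comm _ _) (//-rightDividesˡ y x)

  -- S i w as the rank-one update I + eᵢ(w − eᵢ).
  S-entry : ∀ (i : Fin n) w r j → S i w r j ≈ I n r j + I n r i · (w j - I n i j)
  S-entry {n} i w r j with r Fin.≟ i
  -- Splitting on `r Fin.≟ i` also evaluates the coefficient `I n r i`: to `0#` here, to `1#` in the
  -- other case.
  ... | no r≢i = trans (S-row-other w r≢i j)
    (sym (trans (+-congˡ (zeroˡ _)) (+-identityʳ _)))
  ... | yes ≡.refl = trans (S-row i w j) (sym (begin
    I n i j + 1# · (w j - I n i j)       ≈⟨ +-congˡ (*-identityˡ _) ⟩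
    I n i j + (w j - I n i j)            ≈⟨ y+[x-y]≈x (w j) (I n i j) ⟩
    w j                                  ∎))
    where open SetoidReasoning setoid

  ⊙-S : ∀ (i : Fin n) v w j → (v ⊙ S i w) j ≈ v j + v i · (w j - I n i j)
  ⊙-S {n} i v w j = begin
    sum (λ k → v k · S i w k j)
      ≈⟨ sum-cong-≋ (λ k → trans (*-congˡ (S-entry i w k j)) (distribˡ _ _ _)) ⟩
    sum (λ k → v k · I n k j + v k · (I n k i · d))
      ≈⟨ ∑-distrib-+ (λ k → v k · I n k j) (λ k → v k · (I n k i · d)) ⟩
    sum (λ k → v k · I n k j) + sum (λ k → v k · (I n k i · d))
      ≈⟨ +-cong (⊙-identityʳ v j) (trans (sum-cong-≋ (λ k → sym (*-assoc (v k) (I n k i) d)))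
           (trans (sym (*-distribʳ-sum d (λ k → v k · I n k i))) (*-congʳ (⊙-identityʳ v i)))) ⟩
    v j + v i · d ∎
    where
    open SetoidReasoning setoid
    d = w j - I n i j

  -- Outside row `i` both factors agree with the identity, so only row `i` of the product has to be
  -- checked; `⊙-S` computes it.
  S-*ᴹ-S : ∀ (i : Fin n) v w → (∀ j → v j + v i · (w j - I n i j) ≈ I n i j) →
    S i v *ᴹ S i w ≈ᴹ I n
  S-*ᴹ-S i v w eq r with r Fin.≟ i
  ... | yes ≡.refl = ≋-trans (S-*ᴹ-row i v (S i w)) (λ j → trans (⊙-S i v w j) (eq j))
  ... | no r≢i     = ≋-trans (S-*ᴹ-row-other v (S i w) r≢i) (S-row-other w r≢i)

  -- The inverse is again an instruction on row `i`, with vector `v′`. Its diagonal entry is the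
  -- inverse `u` of `v i`, which supplies the coefficient needed for the product in the other order.
  S-nonsingular : ∀ (i : Fin n) v → AlgebraDefinitions.Invertible _≈_ 1# _·_ (v i) →
    Nonsingular (S i v)
  S-nonsingular {n} i v (u , uvᵢ≈1 , vᵢu≈1) =
    S i v′ , S-*ᴹ-S i v′ v eqˡ , S-*ᴹ-S i v v′ eqʳ
    where
    open SetoidReasoning setoid
    e = I n i

    -- From S(i,v) = I + eᵢ(v − eᵢ) and the Sherman–Morrison formula.
    v′ : Vector Carrier n
    v′ j = e j + u · (e j - v j)

    v′ᵢ≈u : v′ i ≈ u
    v′ᵢ≈u = begin
      e i + u · (e i - v i)      ≈⟨ +-congˡ (x[y-z]≈xy-xz u (e i) (v i)) ⟩
      e i + (u · e i - u · v i)
        ≈⟨ +-cong (I-diagonal i)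
             (+-cong (trans (*-congˡ (I-diagonal i)) (*-identityʳ u)) (-‿cong uvᵢ≈1)) ⟩
      1# + (u - 1#)              ≈⟨ y+[x-y]≈x u 1# ⟩
      u                          ∎

    eqʳ : ∀ j → v j + v i · (v′ j - e j) ≈ e j
    eqʳ j = begin
      v j + v i · (v′ j - e j)         ≈⟨ +-congˡ (*-congˡ (xyx⁻¹≈y (e j) _)) ⟩
      v j + v i · (u · (e j - v j))    ≈⟨ +-congˡ (*-assoc _ _ _) ⟨
      v j + v i · u · (e j - v j)      ≈⟨ +-congˡ (trans (*-congʳ vᵢu≈1) (*-identityˡ _)) ⟩
      v j + (e j - v j)                ≈⟨ y+[x-y]≈x (e j) (v j) ⟩
      e j                              ∎

    eqˡ : ∀ j → v′ j + v′ i · (v j - e j) ≈ e j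
    eqˡ j = begin
      e j + u · (e j - v j) + v′ i · (v j - e j)   ≈⟨ +-congˡ (*-congʳ v′ᵢ≈u) ⟩
      e j + u · (e j - v j) + u · (v j - e j)      ≈⟨ +-assoc _ _ _ ⟩
      e j + (u · (e j - v j) + u · (v j - e j))    ≈⟨ +-congˡ (distribˡ u _ _) ⟨
      e j + u · ((e j - v j) + (v j - e j))        ≈⟨ +-congˡ (*-congˡ cancel) ⟩
      e j + u · 0#                                 ≈⟨ +-congˡ (zeroʳ u) ⟩
      e j + 0#                                     ≈⟨ +-identityʳ _ ⟩
      e j                                          ∎
      where
      cancel : (e j - v j) + (v j - e j) ≈ 0#
      cancel = trans (+-congˡ (sym (⁻¹-anti-homo-// (e j) (v j)))) (-‿inverseʳ _)

  -- Runs of instructions.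

  -- The rows to update are an arbitrary σ and the start an arbitrary N, so that
  -- the tail of a run is again a run.
  run : (Fin m → Fin n) → Matrix n → (Fin m → Vector Carrier n) → Matrix n
  run σ N v = foldl (λ N Sᵢ → Sᵢ *ᴹ N) N λ k → S (σ k) (v k)

  run-cong : ∀ (σ : Fin m → Fin n) {v w} → N ≈ᴹ N′ → (∀ k → v k ≋ w k) → run σ N v ≈ᴹ run σ N′ w
  run-cong {zero}  σ N≈N′ v≋w = N≈N′
  run-cong {suc m} {N = N} {N′} σ {v} {w} N≈N′ v≋w =
    run-cong (σ ∘ suc) {v ∘ suc} {w ∘ suc}
      (λ r → ⊙-cong (S-cong (σ zero) (v≋w zero) r) N≈N′) (v≋w ∘ suc)

  run-row-other : ∀ (σ : Fin m → Fin n) N v {r} → (∀ k → r ≢ σ k) → run σ N v r ≋ N r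
  run-row-other {zero}  σ N v r∉σ = ≋-refl
  run-row-other {suc m} σ N v r∉σ = ≋-trans
    (run-row-other (σ ∘ suc) (S (σ zero) (v zero) *ᴹ N) (v ∘ suc) (r∉σ ∘ suc))
    (S-*ᴹ-row-other (v zero) N (r∉σ zero))

  -- Since `σ` is injective, no later step touches row `σ zero`, so the final matrix still shows the
  -- result of the first step there.
  run-first-row : ∀ (σ : Fin (suc m) → Fin n) → Injective _≡_ _≡_ σ → ∀ N v →
    run σ N v (σ zero) ≋ v zero ⊙ N
  run-first-row σ σ-inj N v = ≋-trans
    (run-row-other (σ ∘ suc) (S (σ zero) (v zero) *ᴹ N) (v ∘ suc) (λ k eq → Fin.0≢1+n (σ-inj eq)))
    (S-*ᴹ-row (σ zero) (v zero) N)

  -- A Heyting field inverts elements apart from zero, whereas instructions only provide `v i ≉ 0#`.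
  -- The assumption bridges the two and is discharged for finite fields by `finite⇒invertible`.
  module _ (invertible : ∀ {x} → x ≉ 0# → AlgebraDefinitions.Invertible _≈_ 1# _·_ x) where

    step-nonsingular : ∀ (i : Fin n) N v → v i ≉ 0# → Nonsingular N → Nonsingular (S i v *ᴹ N)
    step-nonsingular i N v vᵢ≉0 =
      *ᴹ-nonsingular {A = S i v} {N} (S-nonsingular i v (invertible vᵢ≉0))

    run-nonsingular : ∀ (σ : Fin m → Fin n) N v → (∀ k → v k (σ k) ≉ 0#) →
      Nonsingular N → Nonsingular (run σ N v)
    run-nonsingular {zero}  σ N v v≉0 N-ns = N-ns
    run-nonsingular {suc m} σ N v v≉0 N-ns =
      run-nonsingular (σ ∘ suc) _ (v ∘ suc) (v≉0 ∘ suc)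
        (step-nonsingular (σ zero) N (v zero) (v≉0 zero) N-ns)

    -- Row `σ zero` of the result determines `v zero`, by cancelling `N`; then the matrices after
    -- the first step agree and the argument repeats. Two starts `N` and `N′` are carried because
    -- those matrices agree only up to `≈ᴹ`.
    run-injective : ∀ (σ : Fin m → Fin n) → Injective _≡_ _≡_ σ → ∀ N N′ v w →
      (∀ k → v k (σ k) ≉ 0#) → Nonsingular N → N ≈ᴹ N′ →
      run σ N v ≈ᴹ run σ N′ w → ∀ k → v k ≋ w k
    -- A run of length zero has no index `k : Fin zero`, so this is the only clause.
    run-injective {suc m} σ σ-inj N N′ v w v≉0 N-ns N≈N′ eq = λ where
        zero    → v₀≋w₀
        (suc k) → run-injective (σ ∘ suc) (Fin.suc-injective ∘ σ-inj)
          (S (σ zero) (v zero) *ᴹ N) (S (σ zero) (w zero) *ᴹ N′) (v ∘ suc) (w ∘ suc) (v≉0 ∘ suc)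
          (step-nonsingular (σ zero) N (v zero) (v≉0 zero) N-ns)
          (λ r → ⊙-cong (S-cong (σ zero) v₀≋w₀ r) N≈N′)
          eq k
      where
      v₀≋w₀ : v zero ≋ w zero
      v₀≋w₀ = ⊙-cancelʳ {N = N} N-ns
        (≋-trans (≋-sym (run-first-row σ σ-inj N v))
        (≋-trans (eq (σ zero))
        (≋-trans (run-first-row σ σ-inj N′ w) (⊙-cong {v = w zero} ≋-refl (λ r j → sym (N≈N′ r j))))))

  -- Counting programs and computable matrices.

  programs : ℕ → Setoid (c ⊔ ℓ₁) ℓ₁
  programs n = On.setoid {B = Σ[ v ∈ Matrix n ] (∀ i → v i i ≉ 0#)} (matrixSetoid n) proj₁

  -- The nonzero condition sits at a position depending on the row. Pulling the diagonal entry out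
  -- of each row makes all rows range over one setoid, so that `vector-cardinality` applies.
  programs↔rows : ∀ n → Inverse (programs (suc n))
    (VectorEquality.≋-setoid (excluding setoid 0# ×ₛ VectorEquality.≋-setoid setoid n) (suc n))
  programs↔rows n = strictInverse _ _
    (λ (v , v≉0) i → (v i i , v≉0 i) , removeAt (v i) i)
    (λ rows → (λ i → insertAt (proj₂ (rows i)) i (proj₁ (proj₁ (rows i)))) ,
              λ i eq → proj₂ (proj₁ (rows i))
                (trans (sym (reflexive (insertAt-lookup (proj₂ (rows i)) i _))) eq))
    (λ v≈w i → v≈w i i , λ j → v≈w i (punchIn i j))
    (λ eq i → insertAt-cong setoid i (proj₂ (eq i)) (proj₁ (eq i)))
    (λ rows i → reflexive (insertAt-lookup (proj₂ (rows i)) i _) ,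
                λ j → reflexive (removeAt-insertAt (proj₂ (rows i)) i _ j))
    (λ (v , _) i j → reflexive (insertAt-removeAt (v i) i j))

  module _ {q : ℕ} (card : HasCardinality setoid q) where
    open Inverse card

    -- The bijection with `Fin q` makes equality decidable and an inverse searchable. If the search
    -- fails, `x` cannot be apart from zero, and tightness forces `x ≈ 0#`.
    finite⇒invertible : ∀ {x} → x ≉ 0# → AlgebraDefinitions.Invertible _≈_ 1# _·_ x
    finite⇒invertible {x} x≉0
      with Fin.any? (λ k → via-injection (Inverse⇒Injection card) Fin._≟_ (from k · x) 1#)
    ... | yes (k , eq) = invertibleˡ⇒invertible (from k , eq)
    ... | no ¬inv = contradiction (proj₁ (tight x 0#) ¬x#0) x≉0
      where
      ¬x#0 : ¬ (x # 0#)
      ¬x#0 x#0 with y , eq , _ ← #⇒invertible x#0 = ¬inv (to y ,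
        -- Apartness provides an inverse of the difference `x - 0#`, which still has to be
        -- identified with `x`.
        trans (*-cong (strictlyInverseʳ y) (sym (trans (+-congˡ -0#≈0#) (+-identityʳ x)))) eq)

    -- The forward map extracts the program from the computability witness. That equal matrices
    -- yield equal programs is `run-injective`, as `program v` is definitionally `run id (I n) v`.
    computable↔programs : ∀ n → Inverse (computableMatrices n) (programs n)
    computable↔programs n = strictInverse (computableMatrices n) (programs n)
      (λ (_ , _ , v , v≉0 , _) → v , v≉0)
      (λ (v , v≉0) → program v , run-nonsingular finite⇒invertible id (I n) v v≉0 I-nonsingular ,
                     v , v≉0 , ≈ᴹ-refl {A = program v})
      (λ {(M , _ , v , v≉0 , M≈)} {(M′ , _ , w , _ , M′≈)} M≈M′ →
        run-injective finite⇒invertible id id (I n) (I n) v w v≉0 I-nonsingular (≈ᴹ-refl {A = I n})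
          (λ i j → trans (sym (M≈ i j)) (trans (M≈M′ i j) (M′≈ i j))))
      (λ {(v , _)} {(w , _)} v≈w → run-cong id {v} {w} (≈ᴹ-refl {A = I n}) v≈w)
      (λ (v , _) → ≈ᴹ-refl {A = v})
      (λ (_ , _ , _ , _ , M≈) i j → sym (M≈ i j))

    computable-cardinality : ∀ n →
      HasCardinality (computableMatrices (suc n)) (((q ∸ 1) * q ^ n) ^ suc n)
    computable-cardinality n = Composition.inverse (computable↔programs (suc n))
      (Composition.inverse (programs↔rows n)
        (vector-cardinality _ (×-cardinality (excluding-cardinality setoid 0# card)
          (vector-cardinality setoid card n)) (suc n)))

-- Arithmetic of the two closed forms.

^-distribʳ-* : ∀ m n k → (m * n) ^ k ≡ m ^ k * n ^ k
^-distribʳ-* m n zero    = ≡.refl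
^-distribʳ-* m n (suc k) =
  ≡.trans (≡.cong (m * n *_) (^-distribʳ-* m n k)) (ℕ.[m*n]*[o*p]≡[m*o]*[n*p] m n (m ^ k) (n ^ k))

rows-count : ∀ m q n → (m * q ^ n) ^ suc n ≡ m ^ suc n * q ^ (suc n * n)
rows-count m q n = ≡.trans (^-distribʳ-* m (q ^ n) (suc n))
  (≡.cong (m ^ suc n *_) (≡.trans (ℕ.^-*-assoc q n (suc n)) (≡.cong (q ^_) (ℕ.*-comm n (suc n)))))

-- A fraction `m / suc d` is definitionally `fromℚᵘ (mkℚᵘ m d)`, where `d` is the denominator minus
-- one. Additivity and multiplicativity thus reduce fraction identities to cross-multiplication,
-- with no gcds to track.
fromℚᵘ-homo-+ : ∀ p q → ℚ.fromℚᵘ (p ℚᵘ.+ q) ≡ ℚ.fromℚᵘ p ℚ.+ ℚ.fromℚᵘ q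
fromℚᵘ-homo-+ p q = ℚ.toℚᵘ-injective (begin
  ℚ.toℚᵘ (ℚ.fromℚᵘ (p ℚᵘ.+ q))
    ≈⟨ ℚ.toℚᵘ-fromℚᵘ (p ℚᵘ.+ q) ⟩
  p ℚᵘ.+ q
    ≈⟨ ℚᵘ.+-cong (ℚ.toℚᵘ-fromℚᵘ p) (ℚ.toℚᵘ-fromℚᵘ q) ⟨
  ℚ.toℚᵘ (ℚ.fromℚᵘ p) ℚᵘ.+ ℚ.toℚᵘ (ℚ.fromℚᵘ q)
    ≈⟨ ℚ.toℚᵘ-homo-+ (ℚ.fromℚᵘ p) (ℚ.fromℚᵘ q) ⟨
  ℚ.toℚᵘ (ℚ.fromℚᵘ p ℚ.+ ℚ.fromℚᵘ q) ∎)
  where open SetoidReasoning ℚᵘ.≃-setoid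

fromℚᵘ-homo-* : ∀ p q → ℚ.fromℚᵘ (p ℚᵘ.* q) ≡ ℚ.fromℚᵘ p ℚ.* ℚ.fromℚᵘ q
fromℚᵘ-homo-* p q = ℚ.toℚᵘ-injective (begin
  ℚ.toℚᵘ (ℚ.fromℚᵘ (p ℚᵘ.* q))
    ≈⟨ ℚ.toℚᵘ-fromℚᵘ (p ℚᵘ.* q) ⟩
  p ℚᵘ.* q
    ≈⟨ ℚᵘ.*-cong (ℚ.toℚᵘ-fromℚᵘ p) (ℚ.toℚᵘ-fromℚᵘ q) ⟨
  ℚ.toℚᵘ (ℚ.fromℚᵘ p) ℚᵘ.* ℚ.toℚᵘ (ℚ.fromℚᵘ q)
    ≈⟨ ℚ.toℚᵘ-homo-* (ℚ.fromℚᵘ p) (ℚ.fromℚᵘ q) ⟨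
  ℚ.toℚᵘ (ℚ.fromℚᵘ p ℚ.* ℚ.fromℚᵘ q) ∎)
  where open SetoidReasoning ℚᵘ.≃-setoid

/1-homo-* : ∀ m n → + (m * n) / 1 ≡ (+ m / 1) ℚ.* (+ n / 1)
/1-homo-* m n = ≡.trans (≡.cong (_/ 1) (ℤ.pos-* m n)) (fromℚᵘ-homo-* (mkℚᵘ (+ m) 0) (mkℚᵘ (+ n) 0))

/1-homo-^ : ∀ m n → + (m ^ n) / 1 ≡ (+ m / 1) ^ℚ n
/1-homo-^ m zero    = ≡.refl
/1-homo-^ m (suc n) = ≡.trans (/1-homo-* m (m ^ n)) (≡.cong (+ m / 1 ℚ.*_) (/1-homo-^ m n))

[1-1/q]*q≡q∸1 : ∀ q {{_ : NonZero q}} → (1ℚ ℚ.- + 1 / q) ℚ.* (+ q / 1) ≡ + (q ∸ 1) / 1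
-- With `q` matched as `suc r`, the truncated `q ∸ 1` computes to `r`, and the rational subtraction
-- becomes cancellation in `r + 1 - 1`.
[1-1/q]*q≡q∸1 q@(suc r) = begin
  (1ℚ ℚ.- + 1 / q) ℚ.* (+ q / 1)                ≡⟨ [y-z]x≈yx-zx (+ q / 1) 1ℚ (+ 1 / q) ⟩
  1ℚ ℚ.* (+ q / 1) ℚ.- (+ 1 / q) ℚ.* (+ q / 1)  ≡⟨ ≡.cong₂ ℚ._-_ (ℚ.*-identityˡ (+ q / 1)) 1/q*q≡1 ⟩
  (+ q / 1) ℚ.- 1ℚ                              ≡⟨ ≡.cong (ℚ._- 1ℚ) q≡r+1 ⟩
  (+ r / 1) ℚ.+ 1ℚ ℚ.- 1ℚ                       ≡⟨ //-rightDividesʳ 1ℚ (+ r / 1) ⟩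
  + r / 1                                       ∎
  where
  open ≡.≡-Reasoning
  open RingProperties ℚ.+-*-ring using ([y-z]x≈yx-zx; //-rightDividesʳ)
  1/q*q≡1 : (+ 1 / q) ℚ.* (+ q / 1) ≡ 1ℚ
  1/q*q≡1 = ≡.trans (≡.sym (fromℚᵘ-homo-* (mkℚᵘ (+ 1) r) (mkℚᵘ (+ q) 0)))
    (ℚ.fromℚᵘ-cong {mkℚᵘ (+ 1) r ℚᵘ.* mkℚᵘ (+ q) 0} {mkℚᵘ (+ 1) 0}
      (*≡* (≡.trans (ℤ.*-identityʳ _) (≡.cong (λ x → + 1 ℤ.* + x) (≡.sym (ℕ.*-identityʳ q))))))
  q≡r+1 : + q / 1 ≡ (+ r / 1) ℚ.+ 1ℚ
  q≡r+1 = ≡.trans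
    (ℚ.fromℚᵘ-cong {mkℚᵘ (+ q) 0} {mkℚᵘ (+ r) 0 ℚᵘ.+ mkℚᵘ (+ 1) 0}
      (*≡* (≡.cong (ℤ._* + 1)
        (≡.trans (≡.cong +_ (ℕ.+-comm 1 r)) (≡.cong (ℤ._+ + 1) (≡.sym (ℤ.*-identityʳ (+ r))))))))
    (fromℚᵘ-homo-+ (mkℚᵘ (+ r) 0) (mkℚᵘ (+ 1) 0))

-- Each factor q - 1 equals (1 - 1/q) q. The extra factors of q raise the exponent from (n + 1) n to
-- (n + 1)².
count-ℚ : ∀ q n {{_ : NonZero q}} →
  + ((q ∸ 1) ^ suc n * q ^ (suc n * n)) / 1 ≡ (1ℚ ℚ.- + 1 / q) ^ℚ suc n ℚ.* (+ q / 1) ^ℚ (suc n ^ 2)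
count-ℚ q n = begin
  + ((q ∸ 1) ^ n+1 * q ^ (n+1 * n)) / 1
    ≡⟨ /1-homo-* ((q ∸ 1) ^ n+1) (q ^ (n+1 * n)) ⟩
  (+ ((q ∸ 1) ^ n+1) / 1) ℚ.* (+ (q ^ (n+1 * n)) / 1)
    ≡⟨ ≡.cong₂ ℚ._*_ (/1-homo-^ (q ∸ 1) n+1) (/1-homo-^ q (n+1 * n)) ⟩
  (+ (q ∸ 1) / 1) ^ℚ n+1 ℚ.* Q ^ℚ (n+1 * n)
    ≡⟨ ≡.cong (λ x → x ^ℚ n+1 ℚ.* Q ^ℚ (n+1 * n)) ([1-1/q]*q≡q∸1 q) ⟨
  (P ℚ.* Q) ^ℚ n+1 ℚ.* Q ^ℚ (n+1 * n)
    ≡⟨ ≡.cong (ℚ._* Q ^ℚ (n+1 * n)) (^-distrib-* P Q n+1) ⟩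
  P ^ℚ n+1 ℚ.* Q ^ℚ n+1 ℚ.* Q ^ℚ (n+1 * n)
    ≡⟨ ℚ.*-assoc (P ^ℚ n+1) (Q ^ℚ n+1) (Q ^ℚ (n+1 * n)) ⟩
  P ^ℚ n+1 ℚ.* (Q ^ℚ n+1 ℚ.* Q ^ℚ (n+1 * n))
    ≡⟨ ≡.cong (P ^ℚ n+1 ℚ.*_) (^-homo-* Q n+1 (n+1 * n)) ⟨
  P ^ℚ n+1 ℚ.* Q ^ℚ (n+1 ℕ.+ n+1 * n)
    ≡⟨ ≡.cong (λ e → P ^ℚ n+1 ℚ.* Q ^ℚ e) exponent ⟩
  P ^ℚ n+1 ℚ.* Q ^ℚ (n+1 ^ 2) ∎
  where
  open ≡.≡-Reasoning
  open CommutativeExponent (CommutativeRing.commutativeSemiring ℚ.+-*-commutativeRing) using (^-distrib-*)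
  open Exponent (CommutativeRing.semiring ℚ.+-*-commutativeRing) using (^-homo-*)
  n+1 = suc n
  P = 1ℚ ℚ.- + 1 / q
  Q = + q / 1
  exponent : n+1 ℕ.+ n+1 * n ≡ n+1 ^ 2
  exponent = ≡.trans (≡.sym (ℕ.*-suc n+1 n)) (≡.cong (n+1 *_) (≡.sym (ℕ.*-identityʳ n+1)))

proposition5 : ∀ {c ℓ₁ ℓ₂} (q n : ℕ) (q-primePower : IsPrimePower q) → 2 ≤ n →
    (F : HeytingField c ℓ₁ ℓ₂) → HasCardinality (HeytingField.setoid F) q →
    HasCardinality (RowUpdates.computableMatrices F n) ((q ∸ 1) ^ n * q ^ (n * (n ∸ 1)))
    × (+ ((q ∸ 1) ^ n * q ^ (n * (n ∸ 1))) / 1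
    ≡ (1ℚ ℚ.- (_/_ (+ 1) q {{primePower⇒nonZero q-primePower}})) ^ℚ n ℚ.* (+ q / 1) ^ℚ (n ^ 2))
-- The bound `2 ≤ n` rules out zero; writing the dimension as `suc n` makes `suc n ∸ 1` compute to
-- `n`.
proposition5 q (suc n) q-primePower _ F card =
  ≡.subst (HasCardinality (RowUpdates.computableMatrices F (suc n))) (rows-count (q ∸ 1) q n)
    (Matrices.computable-cardinality F card n) ,
  count-ℚ q n {{primePower⇒nonZero q-primePower}}
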